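{- Let $1\le m\le n$ be integers. The complete bipartite graph $K_{m,n}$ is a unit rectangle visibility graph if $m\le 2$ and $n\le 6$, or if $m=3$ and $n\le 4$. Moreover, $K_{m,n}$ is a weak unit rectangle visibility graph if $m\le 2$ (and $n$ is arbitrary), or if $m\le 3$ and $n\le 4$.
   Context: A finite simple graph $G$ is a unit rectangle visibility graph (URVG) if its vertices $v$ can be represented by closed unit squares $S_v$ in the plane with sides parallel to the coordinate axes and with pairwise disjoint interiors (squares may touch along their boundaries), in such a way that two distinct vertices $v,w$ are adjacent if and only if there is an unobstructed non-degenerate (positive width) horizontal or vertical band of visibility joining $S_v$ and $S_w$. Here a horizontal band of visibility joining $S_v$ and $S_w$ is given by an open interval $I$ of positive length such that for every $y_0\in I$ the line $y=y_0$ meets the interiors of both $S_v$ and $S_w$, and the part of this line between $S_v$ and $S_w$ (possibly a single point if the squares touch) meets the interior of no other square of the representation; vertical bands are defined analogously with the roles of $x$ and $y$ exchanged. A graph is a weak unit rectangle visibility graph if it has such a representation in which adjacency of two vertices is only required to imply (rather than be equivalent to) the existence of such a band; equivalently, if it is a subgraph of a URVG. -}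

module Defs where

open import Data.Empty using (⊥)
open import Data.Fin using (Fin)
open import Data.Fin.Properties using (+↔⊎)
open import Data.Nat using (ℕ; _+_)
open import Data.Product using (∃; ∃-syntax; _×_; _,_)
open import Data.Rational as ℚ using (ℚ; 1ℚ)
import Data.Rational.Properties as ℚₚ
open import Data.Sum using (_⊎_; inj₁; inj₂)
open import Data.Unit using (⊤; tt)
open import Function.Bundles using (_↔_; _⇔_; mk⇔; Equivalence)
open import Function.Construct.Symmetry using (↔-sym)
open import Relation.Binary.PropositionalEquality
open import Relation.Nullary using (¬_)

-- Real numbers as two-sided Dedekind cuts: L q means q < x, U q means x < q.
-- Visibility only involves the order and translation by 1, so no further
-- arithmetic is developed.
record ℝ : Set₁ where
  field
    L U         : ℚ → Set
    L-inhabited : ∃ L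
    U-inhabited : ∃ U
    L-rounded   : ∀ q → L q ⇔ (∃[ r ] q ℚ.< r × L r)
    U-rounded   : ∀ q → U q ⇔ (∃[ r ] r ℚ.< q × U r)
    disjoint    : ∀ q → ¬ (L q × U q)
    located     : ∀ q r → q ℚ.< r → L q ⊎ U r

open ℝ

infix 4 _<_ _≤_

_<_ : ℝ → ℝ → Set
x < y = ∃[ q ] U x q × L y q

_≤_ : ℝ → ℝ → Set
x ≤ y = ¬ (y < x)

private
  +1-1 : ∀ q → q ℚ.+ 1ℚ ℚ.- 1ℚ ≡ q
  +1-1 q = trans (ℚₚ.+-assoc q 1ℚ (ℚ.- 1ℚ)) (ℚₚ.+-identityʳ q)

  -1+1 : ∀ q → q ℚ.- 1ℚ ℚ.+ 1ℚ ≡ q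
  -1+1 q = trans (ℚₚ.+-assoc q (ℚ.- 1ℚ) 1ℚ) (ℚₚ.+-identityʳ q)

  -1-mono : ∀ {q r} → q ℚ.< r → q ℚ.- 1ℚ ℚ.< r ℚ.- 1ℚ
  -1-mono = ℚₚ.+-monoˡ-< (ℚ.- 1ℚ)

  +1-mono : ∀ {q r} → q ℚ.< r → q ℚ.+ 1ℚ ℚ.< r ℚ.+ 1ℚ
  +1-mono = ℚₚ.+-monoˡ-< 1ℚ

infix 8 _+1

_+1 : ℝ → ℝ
L (x +1) q = L x (q ℚ.- 1ℚ)
U (x +1) q = U x (q ℚ.- 1ℚ)
L-inhabited (x +1) with L-inhabited x
... | q , Lq = q ℚ.+ 1ℚ , subst (L x) (sym (+1-1 q)) Lq
U-inhabited (x +1) with U-inhabited x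
... | q , Uq = q ℚ.+ 1ℚ , subst (U x) (sym (+1-1 q)) Uq
L-rounded (x +1) q = mk⇔ to from
  where
  to : L x (q ℚ.- 1ℚ) → ∃[ r ] q ℚ.< r × L x (r ℚ.- 1ℚ)
  to Lq with Equivalence.to (L-rounded x (q ℚ.- 1ℚ)) Lq
  ... | r , q-1<r , Lr = r ℚ.+ 1ℚ
                       , subst (ℚ._< r ℚ.+ 1ℚ) (-1+1 q) (+1-mono q-1<r)
                       , subst (L x) (sym (+1-1 r)) Lr

  from : (∃[ r ] q ℚ.< r × L x (r ℚ.- 1ℚ)) → L x (q ℚ.- 1ℚ)
  from (r , q<r , Lr) =
    Equivalence.from (L-rounded x _) (r ℚ.- 1ℚ , -1-mono q<r , Lr)
U-rounded (x +1) q = mk⇔ to from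
  where
  to : U x (q ℚ.- 1ℚ) → ∃[ r ] r ℚ.< q × U x (r ℚ.- 1ℚ)
  to Uq with Equivalence.to (U-rounded x (q ℚ.- 1ℚ)) Uq
  ... | r , r<q-1 , Ur = r ℚ.+ 1ℚ
                       , subst (r ℚ.+ 1ℚ ℚ.<_) (-1+1 q) (+1-mono r<q-1)
                       , subst (U x) (sym (+1-1 r)) Ur

  from : (∃[ r ] r ℚ.< q × U x (r ℚ.- 1ℚ)) → U x (q ℚ.- 1ℚ)
  from (r , r<q , Ur) =
    Equivalence.from (U-rounded x _) (r ℚ.- 1ℚ , -1-mono r<q , Ur)
disjoint (x +1) q = disjoint x (q ℚ.- 1ℚ)
located (x +1) q r q<r = located x (q ℚ.- 1ℚ) (r ℚ.- 1ℚ) (-1-mono q<r)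

record FiniteSimpleGraph : Set₁ where
  field
    Vertex      : Set
    order       : ℕ
    enumeration : Vertex ↔ Fin order
    Adj         : Vertex → Vertex → Set
    Adj-sym     : ∀ {v w} → Adj v w → Adj w v
    Adj-irrefl  : ∀ {v} → ¬ Adj v v

K : ℕ → ℕ → FiniteSimpleGraph
K m n = record
  { Vertex      = Fin m ⊎ Fin n
  ; order       = m + n
  ; enumeration = ↔-sym (+↔⊎ {m} {n})
  ; Adj         = Adj
  ; Adj-sym     = λ {v} {w} → Adj-sym v w
  ; Adj-irrefl  = λ {v} → Adj-irrefl v
  }
  where
  Adj : Fin m ⊎ Fin n → Fin m ⊎ Fin n → Set
  Adj (inj₁ _) (inj₁ _) = ⊥
  Adj (inj₁ _) (inj₂ _) = ⊤
  Adj (inj₂ _) (inj₁ _) = ⊤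
  Adj (inj₂ _) (inj₂ _) = ⊥

  Adj-sym : ∀ v w → Adj v w → Adj w v
  Adj-sym (inj₁ _) (inj₂ _) _ = tt
  Adj-sym (inj₂ _) (inj₁ _) _ = tt

  Adj-irrefl : ∀ v → ¬ Adj v v
  Adj-irrefl (inj₁ _) ()
  Adj-irrefl (inj₂ _) ()

-- The axis-parallel closed unit square [left , left + 1] × [bottom , bottom + 1].
record UnitSquare : Set₁ where
  constructor square
  field
    left bottom : ℝ

  right top : ℝ
  right = left +1
  top   = bottom +1

open UnitSquare

Interior : UnitSquare → ℝ × ℝ → Set
Interior s (x , y) = (left s < x × x < right s) × (bottom s < y × y < top s)

transpose : UnitSquare → UnitSquare
transpose (square x y) = square y x

module _ {V : Set} where

  InteriorsDisjoint : (V → UnitSquare) → Set₁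
  InteriorsDisjoint S = ∀ v w → v ≢ w → ∀ p → ¬ (Interior (S v) p × Interior (S w) p)

  -- Abscissae of the part of a horizontal line meeting both squares that lies
  -- between them, whichever of the two is on the left; it is a single point
  -- when the squares touch.
  Between : UnitSquare → UnitSquare → ℝ → Set
  Between s t x = (right s ≤ x × x ≤ left t) ⊎ (right t ≤ x × x ≤ left s)

  HorizontalBand : (V → UnitSquare) → V → V → Set₁
  HorizontalBand S v w =
    ∃[ a ] ∃[ b ] a < b × (∀ y₀ → a < y₀ → y₀ < b →
      (∃[ x ] Interior (S v) (x , y₀)) ×
      (∃[ x ] Interior (S w) (x , y₀)) ×
      (∀ u → u ≢ v → u ≢ w → ∀ x → Between (S v) (S w) x → ¬ Interior (S u) (x , y₀)))

  VerticalBand : (V → UnitSquare) → V → V → Set₁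
  VerticalBand S = HorizontalBand (λ v → transpose (S v))

  Visible : (V → UnitSquare) → V → V → Set₁
  Visible S v w = HorizontalBand S v w ⊎ VerticalBand S v w

IsURVG : FiniteSimpleGraph → Set₁
IsURVG G = ∃[ S ] InteriorsDisjoint S × (∀ v w → v ≢ w → Adj v w ⇔ Visible S v w)
  where open FiniteSimpleGraph G

IsWeakURVG : FiniteSimpleGraph → Set₁
IsWeakURVG G = ∃[ S ] InteriorsDisjoint S × (∀ v w → v ≢ w → Adj v w → Visible S v w)
  where open FiniteSimpleGraph G

{-# OPTIONS --safe #-}

-- Put the corners of the squares on the grid (1/k)ℤ. Between two consecutive grid
-- lines the pattern of squares met by a parallel line does not change, so a band of
-- visibility exists iff some grid row is a band, and visibility becomes decidable.
-- Explicit layouts then settle K₁,ₙ and K₂,ₙ for n ≤ 6 and K₃,ₙ for n ≤ 4. For the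
-- weak K₂,ₙ, an ascending staircase of n squares of side k = n + 1 is placed
-- between two hubs: square i shows its lowest row to the right hub and its highest
-- row to the left hub.
module Submission where

open import Data.Empty using (⊥-elim)
open import Data.Fin as Fin using (Fin; zero; suc; toℕ; inject≤)
open import Data.Fin.Properties using (all?; toℕ<n; toℕ-injective; inject≤-injective)
import Data.Integer as ℤ
import Data.Integer.Properties as ℤₚ
open import Data.List using (List; []; _∷_)
open import Data.Nat using (ℕ; zero; suc; _+_; _*_; _≤_; _<_; s≤s; z≤n; s≤s⁻¹; _<?_; _≤?_)
import Data.Nat.Properties as ℕₚ
open import Data.Product using (∃; ∃-syntax; _×_; _,_; proj₁; proj₂)
open import Data.Rational as ℚ using (ℚ; 1ℚ)
import Data.Rational.Properties as ℚₚ
open import Data.Rational.Unnormalised using (ℚᵘ; mkℚᵘ; 1ℚᵘ; *<*; *≡*) renaming (_<_ to _<ᵘ_; _≃_ to _≃ᵘ_)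
import Data.Rational.Unnormalised.Properties as ℚᵘₚ
open import Data.Sum as Sum using (_⊎_; inj₁; inj₂; [_,_])
open import Data.Sum.Properties using (≡-dec; inj₁-injective; inj₂-injective)
open import Data.Unit using (tt)
open import Function using (_∘_; case_of_)
open import Function.Bundles using (_⇔_; mk⇔; Equivalence)
open import Relation.Binary using (tri<; tri≈; tri>)
open import Relation.Binary.PropositionalEquality using (_≡_; _≢_; refl; sym; trans; cong; subst)
open import Relation.Nullary using (¬_; Dec; yes; no; contradiction)
open import Relation.Nullary.Decidable using (_×-dec_; _⊎-dec_; _→-dec_; ¬?; map′; from-yes)
open import Defs using
  (K; IsURVG; IsWeakURVG; ℝ; FiniteSimpleGraph; UnitSquare; square; transpose; Interior;
   InteriorsDisjoint; Between; HorizontalBand; Visible; _+1)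
  renaming (_<_ to _<ᴿ_)

open FiniteSimpleGraph using (Vertex; Adj)
open ℝ using (L; U; L-rounded; U-rounded; disjoint)
open Equivalence using (to; from)

-- Cuts against rational numbers

L-down : ∀ y {q r} → q ℚ.< r → L y r → L y q
L-down y q<r Lr = from (L-rounded y _) (_ , q<r , Lr)

U-up : ∀ y {q r} → q ℚ.< r → U y q → U y r
U-up y q<r Uq = from (U-rounded y _) (_ , q<r , Uq)

L<U : ∀ y {q r} → L y q → U y r → q ℚ.< r
L<U y {q} {r} Lq Ur with ℚₚ.<-cmp q r
... | tri< q<r _ _  = q<r
... | tri≈ _ refl _ = ⊥-elim (disjoint y q (Lq , Ur))
... | tri> _ _ r<q  = ⊥-elim (disjoint y r (L-down y r<q Lq , Ur))

fromℚ : ℚ → ℝ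
fromℚ q = record
  { L           = ℚ._< q
  ; U           = q ℚ.<_
  ; L-inhabited = q ℚ.- 1ℚ , subst (q ℚ.- 1ℚ ℚ.<_) (ℚₚ.+-identityʳ q) (ℚₚ.+-monoʳ-< q (ℚₚ.negative⁻¹ (ℚ.- 1ℚ)))
  ; U-inhabited = q ℚ.+ 1ℚ , subst (ℚ._< q ℚ.+ 1ℚ) (ℚₚ.+-identityʳ q) (ℚₚ.+-monoʳ-< q (ℚₚ.positive⁻¹ 1ℚ))
  ; L-rounded   = λ r → mk⇔ (λ r<q → let s , r<s , s<q = ℚₚ.<-dense r<q in s , r<s , s<q)
                            (λ (s , r<s , s<q) → ℚₚ.<-trans r<s s<q)
  ; U-rounded   = λ r → mk⇔ (λ q<r → let s , q<s , s<r = ℚₚ.<-dense q<r in s , s<r , q<s)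
                            (λ (s , s<r , q<s) → ℚₚ.<-trans q<s s<r)
  ; disjoint    = λ r (r<q , q<r) → ℚₚ.<-asym r<q q<r
  ; located     = located
  }
  where
  located : ∀ r s → r ℚ.< s → r ℚ.< q ⊎ q ℚ.< s
  located r s r<s with r ℚₚ.<? q
  ... | yes r<q = inj₁ r<q
  ... | no  r≮q = inj₂ (ℚₚ.≤-<-trans (ℚₚ.≮⇒≥ r≮q) r<s)

fromℚ<⇔L : ∀ q y → (fromℚ q <ᴿ y) ⇔ L y q
fromℚ<⇔L q y = mk⇔ (λ (r , q<r , Lr) → L-down y q<r Lr) (to (L-rounded y q))

<fromℚ⇔U : ∀ q y → (y <ᴿ fromℚ q) ⇔ U y q
<fromℚ⇔U q y = mk⇔
  (λ (r , Ur , r<q) → U-up y r<q Ur)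
  (λ Uq → let r , r<q , Ur = to (U-rounded y q) Uq in r , Ur , r<q)

-1<⇔<+1 : ∀ r q → (r ℚ.- 1ℚ ℚ.< q) ⇔ (r ℚ.< q ℚ.+ 1ℚ)
-1<⇔<+1 r q = mk⇔
  (λ lt → subst (ℚ._< q ℚ.+ 1ℚ) (trans (ℚₚ.+-assoc r (ℚ.- 1ℚ) 1ℚ) (ℚₚ.+-identityʳ r)) (ℚₚ.+-monoˡ-< 1ℚ lt))
  (λ lt → subst (r ℚ.- 1ℚ ℚ.<_) (trans (ℚₚ.+-assoc q 1ℚ (ℚ.- 1ℚ)) (ℚₚ.+-identityʳ q)) (ℚₚ.+-monoˡ-< (ℚ.- 1ℚ) lt))

<fromℚ+1⇔U : ∀ q y → (y <ᴿ fromℚ q +1) ⇔ U y (q ℚ.+ 1ℚ)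
<fromℚ+1⇔U q y = mk⇔
  (λ (r , Ur , r-1<q) → U-up y (to (-1<⇔<+1 r q) r-1<q) Ur)
  (λ Uq → let r , r<q+1 , Ur = to (U-rounded y _) Uq in r , Ur , from (-1<⇔<+1 r q) r<q+1)

-- The grid of multiples of 1/k

module Grid (d : ℕ) where

  k : ℕ
  k = suc d

  -- The fraction i/k: `mkℚᵘ` stores the denominator minus one. The normalised `π` is handled only
  -- through `toℚᵘ-π`, never by reducing to lowest terms.
  πᵘ : ℕ → ℚᵘ
  πᵘ i = mkℚᵘ (ℤ.+ i) d

  opaque
    π : ℕ → ℚ
    π i = ℚ.fromℚᵘ (πᵘ i)

    toℚᵘ-π : ∀ i → ℚ.toℚᵘ (π i) ≃ᵘ πᵘ i
    toℚᵘ-π i = ℚₚ.toℚᵘ-fromℚᵘ (πᵘ i)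

  π-mono-< : ∀ {i j} → i < j → π i ℚ.< π j
  π-mono-< {i} {j} i<j = ℚₚ.toℚᵘ-cancel-<
    (ℚᵘₚ.<-respˡ-≃ (ℚᵘₚ.≃-sym (toℚᵘ-π i))
      (ℚᵘₚ.<-respʳ-≃ (ℚᵘₚ.≃-sym (toℚᵘ-π j)) πᵘi<πᵘj))
    where
    πᵘi<πᵘj : πᵘ i <ᵘ πᵘ j
    πᵘi<πᵘj = *<* (ℤₚ.*-monoʳ-<-pos (ℤ.+ k) (ℤ.+<+ i<j))

  π-mono-≤ : ∀ {i j} → i ≤ j → π i ℚ.≤ π j
  π-mono-≤ i≤j with ℕₚ.m≤n⇒m<n∨m≡n i≤j
  ... | inj₁ i<j  = ℚₚ.<⇒≤ (π-mono-< i<j)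
  ... | inj₂ refl = ℚₚ.≤-refl

  π-cancel-< : ∀ {i j} → π i ℚ.< π j → i < j
  π-cancel-< πi<πj = ℕₚ.≰⇒> (λ j≤i → ℚₚ.<-irrefl refl (ℚₚ.<-≤-trans πi<πj (π-mono-≤ j≤i)))

  π-+k : ∀ i → π i ℚ.+ 1ℚ ≡ π (i + k)
  π-+k i = ℚₚ.toℚᵘ-injective
    (ℚᵘₚ.≃-trans (ℚₚ.toℚᵘ-homo-+ (π i) 1ℚ)
    (ℚᵘₚ.≃-trans (ℚᵘₚ.+-congˡ 1ℚᵘ (toℚᵘ-π i))
    (ℚᵘₚ.≃-trans (*≡* πᵘ-+k)
      (ℚᵘₚ.≃-sym (toℚᵘ-π (i + k))))))
    where
    -- The cross-multiplied form of i/k + 1/1 = (i + k)/k; `suc (d * 1)` is the denominator of the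
    -- sum.
    πᵘ-+k : (ℤ.+ i ℤ.* ℤ.+ 1 ℤ.+ ℤ.+ 1 ℤ.* ℤ.+ k) ℤ.* ℤ.+ k ≡ ℤ.+ (i + k) ℤ.* ℤ.+ suc (d * 1)
    πᵘ-+k rewrite ℕₚ.*-identityʳ d | ℤₚ.*-identityʳ (ℤ.+ i) | ℕₚ.+-identityʳ d = refl

  L-down-≤ : ∀ y {i j} → i ≤ j → L y (π j) → L y (π i)
  L-down-≤ y i≤j Lj with ℕₚ.m≤n⇒m<n∨m≡n i≤j
  ... | inj₁ i<j  = L-down y (π-mono-< i<j) Lj
  ... | inj₂ refl = Lj

  U-up-≤ : ∀ y {i j} → i ≤ j → U y (π i) → U y (π j)
  U-up-≤ y i≤j Ui with ℕₚ.m≤n⇒m<n∨m≡n i≤j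
  ... | inj₁ i<j  = U-up y (π-mono-< i<j) Ui
  ... | inj₂ refl = Ui

  L<U-grid : ∀ y {i j} → L y (π i) → U y (π j) → i < j
  L<U-grid y Li Uj = π-cancel-< (L<U y Li Uj)

  pt : ℕ → ℝ
  pt i = fromℚ (π i)

  Inside : ℕ → ℝ → Set
  Inside i y = (pt i <ᴿ y) × (y <ᴿ pt i +1)

  <pt+1⇔U : ∀ i y → (y <ᴿ pt i +1) ⇔ U y (π (i + k))
  <pt+1⇔U i y = subst (λ q → (y <ᴿ pt i +1) ⇔ U y q) (π-+k i) (<fromℚ+1⇔U (π i) y)

  inside⁺ : ∀ i y → L y (π i) → U y (π (i + k)) → Inside i y
  inside⁺ i y Ly Uy = from (fromℚ<⇔L (π i) y) Ly , from (<pt+1⇔U i y) Uy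

  inside⁻ : ∀ i y → Inside i y → L y (π i) × U y (π (i + k))
  inside⁻ i y (pt<y , y<pt+1) = to (fromℚ<⇔L (π i) y) pt<y , to (<pt+1⇔U i y) y<pt+1

  inside-nonempty : ∀ i → ∃ (Inside i)
  inside-nonempty i =
    let q , πi<q , q<πi+k = ℚₚ.<-dense (π-mono-< (ℕₚ.m<m+n i (s≤s z≤n)))
    in fromℚ q , inside⁺ i (fromℚ q) πi<q q<πi+k

  -- A line may be moved off the grid lines within any band.
  row-of-interval : ∀ c i {q r} → π i ℚ.≤ q → r ℚ.≤ π (c + i) → q ℚ.< r →
    ∃[ j ] ∃[ s ] (π j ℚ.< s × s ℚ.< π (suc j)) × (q ℚ.< s × s ℚ.< r)
  row-of-interval zero i πi≤q r≤πi q<r =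
    contradiction (ℚₚ.<-≤-trans q<r (ℚₚ.≤-trans r≤πi πi≤q)) (ℚₚ.<-irrefl refl)
  row-of-interval (suc c) i {q} {r} πi≤q r≤ q<r with q ℚₚ.<? π (suc i)
  ... | no  q≮ = row-of-interval c (suc i) (ℚₚ.≮⇒≥ q≮) (subst (λ e → r ℚ.≤ π e) (sym (ℕₚ.+-suc c i)) r≤) q<r
  ... | yes q<πi+1 with r ℚₚ.≤? π (suc i)
  ...   | yes r≤πi+1 = let s , q<s , s<r = ℚₚ.<-dense q<r in
                       i , s , (ℚₚ.≤-<-trans πi≤q q<s , ℚₚ.<-≤-trans s<r r≤πi+1) , q<s , s<r
  ...   | no  r≰πi+1 = let s , q<s , s<πi+1 = ℚₚ.<-dense q<πi+1 in
                       i , s , (ℚₚ.≤-<-trans πi≤q q<s , s<πi+1) , q<s , ℚₚ.<-trans s<πi+1 (ℚₚ.≰⇒> r≰πi+1)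

  -- Layouts on the grid and their bands

  module _ {V : Set} where

    layout : (V → ℕ) → (V → ℕ) → V → UnitSquare
    layout x y v = square (pt (x v)) (pt (y v))

    -- Index j stands for the open strip between the grid lines j/k and (j + 1)/k; a unit square
    -- starting at b/k covers k such strips.
    Row : ℕ → ℕ → Set
    Row b j = b ≤ j × j < b + k

    -- Comparing left sides suffices: separated squares that meet a common row have left sides at
    -- least k apart.
    StrictlyBetween : (V → ℕ) → V → V → V → Set
    StrictlyBetween x v w u = (x v < x u × x u < x w) ⊎ (x w < x u × x u < x v)

    -- The upper bound on j comes first to give the bounded search shape of `anyUpTo?`. Neither v
    -- nor w is ever strictly between the two, so u can range over all of V.
    GridBand : (V → ℕ) → (V → ℕ) → V → V → Set
    GridBand x y v w =
      ∃[ j ] j < y v + k × y v ≤ j × Row (y w) j ×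
             (∀ u → Row (y u) j → ¬ StrictlyBetween x v w u)

    GridVisible : (V → ℕ) → (V → ℕ) → V → V → Set
    GridVisible x y v w = GridBand x y v w ⊎ GridBand y x v w

    SidesApart : (V → ℕ) → V → V → Set
    SidesApart x v w = x v + k ≤ x w ⊎ x w + k ≤ x v

    Apart : (V → ℕ) → (V → ℕ) → V → V → Set
    Apart x y v w = SidesApart x v w ⊎ SidesApart y v w

    AllApart : (V → ℕ) → (V → ℕ) → Set
    AllApart x y = ∀ v w → v ≢ w → Apart x y v w

    not-inside-both : ∀ x {v w} p → SidesApart x v w → ¬ (Inside (x v) p × Inside (x w) p)
    not-inside-both x {v} {w} p apart (inv , inw)
      with Lv , Uv ← inside⁻ (x v) p inv | Lw , Uw ← inside⁻ (x w) p inw | apart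
    ... | inj₁ v≤w = ℕₚ.<⇒≱ (L<U-grid p Lw Uv) v≤w
    ... | inj₂ w≤v = ℕₚ.<⇒≱ (L<U-grid p Lv Uw) w≤v

    layout-disjoint : ∀ {x y} → AllApart x y → InteriorsDisjoint (layout x y)
    layout-disjoint {x} {y} apart v w v≢w (p , q) ((xv , yv) , (xw , yw)) with apart v w v≢w
    ... | inj₁ ax = not-inside-both x p ax (xv , xw)
    ... | inj₂ ay = not-inside-both y q ay (yv , yw)

    -- A shared row makes the vertical extents overlap, which rules out vertical separation.
    same-row⇒apart : ∀ {x y v w j} → Row (y v) j → Row (y w) j → Apart x y v w → SidesApart x v w
    same-row⇒apart _ _ (inj₁ ax) = ax
    same-row⇒apart (_ , j<v+k) (w≤j , _) (inj₂ (inj₁ v+k≤w)) =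
      contradiction (ℕₚ.<-≤-trans j<v+k (ℕₚ.≤-trans v+k≤w w≤j)) (ℕₚ.<-irrefl refl)
    same-row⇒apart (v≤j , _) (_ , j<w+k) (inj₂ (inj₂ w+k≤v)) =
      contradiction (ℕₚ.<-≤-trans j<w+k (ℕₚ.≤-trans w+k≤v v≤j)) (ℕₚ.<-irrefl refl)

    <∧apart⇒+k≤ : ∀ {x v w} → x v < x w → SidesApart x v w → x v + k ≤ x w
    <∧apart⇒+k≤ _ (inj₁ v+k≤w) = v+k≤w
    <∧apart⇒+k≤ v<w (inj₂ w+k≤v) = contradiction (ℕₚ.≤-trans (ℕₚ.m≤m+n _ k) w+k≤v) (ℕₚ.<⇒≱ v<w)

    row⇒inside : ∀ b {j} y → Row b j → L y (π j) → U y (π (suc j)) → Inside b y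
    row⇒inside b y (b≤j , j<b+k) Lj Uj = inside⁺ b y (L-down-≤ y b≤j Lj) (U-up-≤ y j<b+k Uj)

    inside⇒row : ∀ b {j} y → Inside b y → L y (π j) → U y (π (suc j)) → Row b j
    inside⇒row b y ins Lj Uj =
      let Lb , Ub = inside⁻ b y ins in s≤s⁻¹ (L<U-grid y Lb Uj) , L<U-grid y Lj Ub

    module _ {x y : V → ℕ} where

      private
        S = layout x y

      -- The whole open strip j serves as the band: a line in it meets the interiors of exactly the
      -- squares that cover row j.
      gridBand⇒band : ∀ {v w} → GridBand x y v w → HorizontalBand S v w
      gridBand⇒band {v} {w} (j , j<v+k , v≤j , wj , clear) =
        pt j , pt (suc j) , ℚₚ.<-dense (π-mono-< (ℕₚ.n<1+n j)) ,
        λ y₀ pt<y₀ y₀<pt →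
          let Lj = to (fromℚ<⇔L (π j) y₀) pt<y₀
              Uj = to (<fromℚ⇔U (π (suc j)) y₀) y₀<pt
              interior : ∀ v → Row (y v) j → ∃[ p ] Interior (S v) (p , y₀)
              interior v vj = let p , in-p = inside-nonempty (x v) in p , in-p , row⇒inside (y v) y₀ vj Lj Uj
          in interior v (v≤j , j<v+k) , interior w wj ,
             λ u _ _ p btw (in-p , in-y₀) → clear u (inside⇒row (y u) y₀ in-y₀ Lj Uj) (strict u p btw in-p)
        where
        strict-from : ∀ v w u p → ¬ (p <ᴿ pt (x v) +1) → ¬ (pt (x w) <ᴿ p) → Inside (x u) p →
          x v < x u × x u < x w
        strict-from v w u p p≮v w≮p in-p =
          let Lu , Uu = inside⁻ (x u) p in-p in
          -- If x u ≤ x v, then p, being left of the right side of square u, would be left of that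
          -- of square v; symmetrically for w.
          ℕₚ.≰⇒> (λ u≤v → p≮v (from (<pt+1⇔U (x v) p) (U-up-≤ p (ℕₚ.+-monoˡ-≤ k u≤v) Uu))) ,
          ℕₚ.≰⇒> (λ w≤u → w≮p (from (fromℚ<⇔L (π (x w)) p) (L-down-≤ p w≤u Lu)))

        strict : ∀ u p → Between {V} (S v) (S w) p → Inside (x u) p → StrictlyBetween x v w u
        strict u p (inj₁ (v≤p , p≤w)) in-p = inj₁ (strict-from v w u p v≤p p≤w in-p)
        strict u p (inj₂ (w≤p , p≤v)) in-p = inj₂ (strict-from w v u p w≤p p≤v in-p)

      band⇒gridBand : AllApart x y → ∀ {v w} → HorizontalBand S v w → GridBand x y v w
      band⇒gridBand apart {v} {w} (a , b , (q , Uq , Lq) , band)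
        -- The ends a and b are arbitrary cuts, so rationals q < r < r′ < q′ are chosen inside the
        -- band.
        with q′ , q<q′ , Lq′ ← to (L-rounded b q) Lq
        with r , q<r , r<q′ ← ℚₚ.<-dense q<q′
        with r′ , r<r′ , r′<q′ ← ℚₚ.<-dense r<q′
        with band-at ← (λ s q<s s<q′ → band (fromℚ s) (q , Uq , q<s) (q′ , s<q′ , Lq′))
        with (_ , _ , r-in) , _ ← band-at r q<r r<q′
           | (_ , _ , r′-in) , _ ← band-at r′ (ℚₚ.<-trans q<r r<r′) r′<q′
        with πv<r , _ ← inside⁻ (y v) (fromℚ r) r-in | _ , r′<πv+k ← inside⁻ (y v) (fromℚ r′) r′-in
        -- Both r and r′ lie strictly between bottom and top of square v, so searching its k strips
        -- finds a rational s between them and off the grid lines.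
        with j , s , (πj<s , s<πj+1) , r<s , s<r′ ←
               row-of-interval k (y v) (ℚₚ.<⇒≤ πv<r)
                 (subst (λ e → r′ ℚ.≤ π e) (ℕₚ.+-comm (y v) k) (ℚₚ.<⇒≤ r′<πv+k)) r<r′
        with (_ , _ , v-in) , (_ , _ , w-in) , clear ← band-at s (ℚₚ.<-trans q<r r<s) (ℚₚ.<-trans s<r′ r′<q′)
        = j , proj₂ vj , proj₁ vj , wj , unblocked
        where
        s⇒row : ∀ i → Inside i (fromℚ s) → Row i j
        s⇒row i ins = inside⇒row i (fromℚ s) ins πj<s s<πj+1

        vj = s⇒row (y v) v-in
        wj = s⇒row (y w) w-in

        x-distinct : ∀ {u v : V} → x u ≢ x v → u ≢ v
        x-distinct ne refl = ne refl

        -- Here disjointness enters: in a common row, strict order of left sides widens to a gap of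
        -- at least k, so all of square u lies between squares v and w.
        separates : ∀ v w u p → Row (y v) j → Row (y w) j → Row (y u) j → x v < x u → x u < x w →
          Inside (x u) p → ¬ (p <ᴿ pt (x v) +1) × ¬ (pt (x w) <ᴿ p)
        separates v w u p vj wj uj v<u u<w in-p =
          let Lu , Uu = inside⁻ (x u) p in-p in
          (λ p<v → ℕₚ.<⇒≱ (L<U-grid p Lu (to (<pt+1⇔U (x v) p) p<v))
             (<∧apart⇒+k≤ {x} v<u (same-row⇒apart {y = y} vj uj (apart v u (x-distinct (ℕₚ.<⇒≢ v<u)))))) ,
          (λ w<p → ℕₚ.<⇒≱ (L<U-grid p (to (fromℚ<⇔L (π (x w)) p) w<p) Uu)
             (<∧apart⇒+k≤ {x} u<w (same-row⇒apart {y = y} uj wj (apart u w (x-distinct (ℕₚ.<⇒≢ u<w))))))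

        unblocked : ∀ u → Row (y u) j → ¬ StrictlyBetween x v w u
        unblocked u uj between =
          let p , in-p = inside-nonempty (x u)
              u-in = in-p , row⇒inside (y u) (fromℚ s) uj πj<s s<πj+1
          in case between of λ where
            (inj₁ (v<u , u<w)) → clear u (x-distinct (ℕₚ.>⇒≢ v<u)) (x-distinct (ℕₚ.<⇒≢ u<w)) p
                                   (inj₁ (separates v w u p vj wj uj v<u u<w in-p)) u-in
            (inj₂ (w<u , u<v)) → clear u (x-distinct (ℕₚ.<⇒≢ u<v)) (x-distinct (ℕₚ.>⇒≢ w<u)) p
                                   (inj₂ (separates w v u p wj vj uj w<u u<v in-p)) u-in

    gridVisible⇒visible : ∀ {x y v w} → GridVisible x y v w → Visible (layout x y) v w
    gridVisible⇒visible {x} {y} = Sum.map (gridBand⇒band {x} {y}) (gridBand⇒band {y} {x})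

    visible⇒gridVisible : ∀ {x y} → AllApart x y → ∀ {v w} → Visible (layout x y) v w → GridVisible x y v w
    visible⇒gridVisible {x} {y} apart =
      Sum.map (band⇒gridBand {x} {y} apart)
              (band⇒gridBand {y} {x} (λ v w v≢w → Sum.swap (apart v w v≢w)))

    gridBand-sym : ∀ {x y v w} → GridBand x y v w → GridBand x y w v
    gridBand-sym (j , j<v+k , v≤j , (w≤j , j<w+k) , clear) =
      j , j<w+k , w≤j , (v≤j , j<v+k) , λ u uj → clear u uj ∘ Sum.swap

    -- Stated pair by pair, so that an explicit finite layout is verified by one decision procedure.
    Represents : (V → V → Set) → (V → ℕ) → (V → ℕ) → Set
    Represents E x y = ∀ v w → v ≢ w →
      Apart x y v w × (E v w → GridVisible x y v w) × (GridVisible x y v w → E v w)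

  represents⇒URVG : ∀ G {x y} → Represents (Adj G) x y → IsURVG G
  represents⇒URVG G {x} {y} rep = layout x y , layout-disjoint {x = x} {y} apart , λ v w v≢w →
    let _ , sees , seen = rep v w v≢w in
    mk⇔ (gridVisible⇒visible {x = x} {y} ∘ sees) (seen ∘ visible⇒gridVisible {x = x} {y} apart)
    where
    apart = λ v w v≢w → proj₁ (rep v w v≢w)

  gridVisible⇒weakURVG : ∀ G {x y} → AllApart x y →
    (∀ v w → Adj G v w → GridVisible x y v w) → IsWeakURVG G
  gridVisible⇒weakURVG G {x} {y} apart sees =
    layout x y , layout-disjoint {x = x} {y} apart ,
    λ v w _ adj → gridVisible⇒visible {x = x} {y} (sees v w adj)

-- Deciding visibility and checking explicit layouts

all⊎? : ∀ {m n} {P : Fin m ⊎ Fin n → Set} → (∀ v → Dec (P v)) → Dec (∀ v → P v)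
all⊎? P? = map′ (λ (f , g) → [ f , g ]) (λ h → h ∘ inj₁ , h ∘ inj₂)
                (all? (P? ∘ inj₁) ×-dec all? (P? ∘ inj₂))

K-adj? : ∀ m n v w → Dec (Adj (K m n) v w)
K-adj? m n (inj₁ _) (inj₁ _) = no λ ()
K-adj? m n (inj₁ _) (inj₂ _) = yes tt
K-adj? m n (inj₂ _) (inj₁ _) = yes tt
K-adj? m n (inj₂ _) (inj₂ _) = no λ ()

module _ (d m n : ℕ) (x y : Fin m ⊎ Fin n → ℕ) where

  open Grid d

  gridBand? : ∀ x y (v w : Fin m ⊎ Fin n) → Dec (GridBand x y v w)
  gridBand? x y v w = ℕₚ.anyUpTo?
    (λ j → y v ≤? j ×-dec row? w j ×-dec all⊎? (λ u → row? u j →-dec ¬? (strictlyBetween? u))) (y v + k)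
    where
    row? : ∀ u j → Dec (Row {Fin m ⊎ Fin n} (y u) j)
    row? u j = y u ≤? j ×-dec j <? y u + k

    strictlyBetween? : ∀ u → Dec (StrictlyBetween x v w u)
    strictlyBetween? u = (x v <? x u ×-dec x u <? x w) ⊎-dec (x w <? x u ×-dec x u <? x v)

  gridVisible? : ∀ v w → Dec (GridVisible x y v w)
  gridVisible? v w = gridBand? x y v w ⊎-dec gridBand? y x v w

  apart? : ∀ v w → Dec (Apart x y v w)
  apart? v w = (x v + k ≤? x w ⊎-dec x w + k ≤? x v) ⊎-dec (y v + k ≤? y w ⊎-dec y w + k ≤? y v)

  represents? : Dec (Represents (Adj (K m n)) x y)
  represents? = all⊎? λ v → all⊎? λ w → ¬? (≡-dec Fin._≟_ Fin._≟_ v w) →-dec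
    (apart? v w ×-dec (K-adj? m n v w →-dec gridVisible? v w) ×-dec (gridVisible? v w →-dec K-adj? m n v w))

-- The value past the end of the list is never used.
nth : List (ℕ × ℕ) → ℕ → ℕ × ℕ
nth []       _       = 0 , 0
nth (p ∷ _)  zero    = p
nth (_ ∷ ps) (suc i) = nth ps i

position : List (ℕ × ℕ) → List (ℕ × ℕ) → ∀ {m n} → Fin m ⊎ Fin n → ℕ × ℕ
position ps qs = [ nth ps ∘ toℕ , nth qs ∘ toℕ ]

-- Every initial segment of the leaves in the layouts below is a layout as well.
initial-segments? : ∀ d m ps qs N → Dec (∀ {n} → n < N →
  Grid.Represents d (Adj (K m n)) (proj₁ ∘ position ps qs) (proj₂ ∘ position ps qs))
initial-segments? d m ps qs = ℕₚ.allUpTo? (λ n → represents? d m n _ _)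

-- Coordinates count half units. Two leaves above the hub and two to its left are staggered corner
-- to corner, each seeing half a side; the leaves below and to the right are aligned with the hub,
-- which hides them from these pairs.
K₁ₙ-URVG : ∀ {n} → n < 7 → IsURVG (K 1 n)
K₁ₙ-URVG {n} n<7 = Grid.represents⇒URVG 1 (K 1 n) (from-yes
  (initial-segments? 1 1 ((6 , 3) ∷ [])
     ((5 , 9) ∷ (7 , 7) ∷ (2 , 4) ∷ (0 , 2) ∷ (6 , 0) ∷ (10 , 3) ∷ []) 7) n<7)

-- The two hubs touch in a corner, so that together they separate the outer leaves.
K₂ₙ-URVG : ∀ {n} → n < 7 → IsURVG (K 2 n)
K₂ₙ-URVG {n} n<7 = Grid.represents⇒URVG 1 (K 2 n) (from-yes
  (initial-segments? 1 2 ((3 , 3) ∷ (5 , 5) ∷ [])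
     ((6 , 2) ∷ (2 , 6) ∷ (0 , 4) ∷ (8 , 4) ∷ (4 , 0) ∷ (4 , 8) ∷ []) 7) n<7)

-- Coordinates count thirds. No two leaves share a row or column, and no two hubs do, so only hub
-- and leaf can see each other.
K₃ₙ-URVG : ∀ {n} → n < 5 → IsURVG (K 3 n)
K₃ₙ-URVG {n} n<5 = Grid.represents⇒URVG 2 (K 3 n) (from-yes
  (initial-segments? 2 3 ((6 , 4) ∷ (2 , 7) ∷ (9 , 1) ∷ [])
     ((4 , 0) ∷ (7 , 9) ∷ (11 , 6) ∷ (0 , 3) ∷ []) 5) n<5)

-- The staircase for two hubs and any number of leaves

module Staircase (n : ℕ) where

  open Grid n

  -- `rank` is the order from left to right, one column of width k per square. The left hub covers
  -- rows n to 2n, the right hub rows 0 to n, leaf i rows i to i + n.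
  rank x y : Fin 2 ⊎ Fin n → ℕ
  rank (inj₁ zero)    = 0
  rank (inj₁ (suc _)) = suc n
  rank (inj₂ i)       = suc (toℕ i)

  x v = rank v * k

  y (inj₁ zero)    = n
  y (inj₁ (suc _)) = 0
  y (inj₂ i)       = toℕ i

  rank-injective : ∀ v w → rank v ≡ rank w → v ≡ w
  rank-injective (inj₁ zero)       (inj₁ zero)       _  = refl
  rank-injective (inj₁ (suc zero)) (inj₁ (suc zero)) _  = refl
  rank-injective (inj₁ (suc zero)) (inj₂ j)          eq = contradiction (sym (ℕₚ.suc-injective eq)) (ℕₚ.<⇒≢ (toℕ<n j))
  rank-injective (inj₂ i)          (inj₁ (suc zero)) eq = contradiction (ℕₚ.suc-injective eq) (ℕₚ.<⇒≢ (toℕ<n i))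
  rank-injective (inj₂ i)          (inj₂ j)          eq = cong inj₂ (toℕ-injective (ℕₚ.suc-injective eq))

  x-step : ∀ v w → rank v < rank w → x v + k ≤ x w
  x-step v w v<w = subst (_≤ x w) (ℕₚ.+-comm k (x v)) (ℕₚ.*-monoˡ-≤ k v<w)

  apart : AllApart x y
  apart v w v≢w with ℕₚ.<-cmp (rank v) (rank w)
  ... | tri< v<w _ _ = inj₁ (inj₁ (x-step v w v<w))
  ... | tri≈ _ v≡w _ = contradiction (rank-injective v w v≡w) v≢w
  ... | tri> _ _ w<v = inj₁ (inj₂ (x-step w v w<v))

  between-ranks : ∀ v w u → StrictlyBetween x v w u → StrictlyBetween rank v w u
  between-ranks v w u = Sum.map cancel cancel
    where
    cancel : ∀ {a b c} → a * k < b * k × b * k < c * k → a < b × b < c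
    cancel (a<b , b<c) = ℕₚ.*-cancelʳ-< _ _ _ a<b , ℕₚ.*-cancelʳ-< _ _ _ b<c

  left-hub-sees : ∀ i → GridBand x y (inj₁ zero) (inj₂ i)
  left-hub-sees i =
    toℕ i + n , subst (_< n + k) (ℕₚ.+-comm n (toℕ i)) (ℕₚ.+-monoʳ-< n (ℕₚ.m<n⇒m<1+n (toℕ<n i))) ,
    ℕₚ.m≤n+m n (toℕ i) , (ℕₚ.m≤m+n (toℕ i) n , ℕₚ.+-monoʳ-< (toℕ i) (ℕₚ.n<1+n n)) ,
    λ u uj btw → clear u uj (between-ranks (inj₁ zero) (inj₂ i) u btw)
    where
    clear : ∀ u → Row {Fin 2} (y u) (toℕ i + n) → ¬ StrictlyBetween rank (inj₁ zero) (inj₂ i) u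
    clear (inj₁ (suc _)) _ (inj₁ (_ , B<i)) = ℕₚ.<-asym B<i (s≤s (toℕ<n i))
    -- A leaf j left of leaf i ends at row j + n, below row i + n.
    clear (inj₂ j) (_ , i+n<j+k) (inj₁ (_ , j<i)) =
      ℕₚ.<⇒≱ j<i (ℕₚ.+-cancelʳ-< n _ _ (subst (toℕ i + n <_) (ℕₚ.+-suc (toℕ j) n) i+n<j+k))

  right-hub-sees : ∀ i → GridBand x y (inj₁ (suc zero)) (inj₂ i)
  right-hub-sees i =
    toℕ i , ℕₚ.m<n⇒m<1+n (toℕ<n i) , z≤n , (ℕₚ.≤-refl , ℕₚ.m<m+n (toℕ i) (s≤s z≤n)) ,
    λ u uj btw → clear u uj (between-ranks (inj₁ (suc zero)) (inj₂ i) u btw)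
    where
    clear : ∀ u → Row {Fin 2} (y u) (toℕ i) → ¬ StrictlyBetween rank (inj₁ (suc zero)) (inj₂ i) u
    clear u _ (inj₁ (B<u , u<i)) = ℕₚ.<-asym (ℕₚ.<-trans B<u u<i) (s≤s (toℕ<n i))
    clear (inj₁ (suc zero)) _ (inj₂ (_ , B<B)) = ℕₚ.<-irrefl refl B<B
    -- A leaf right of leaf i starts above row i.
    clear (inj₂ j) (j≤i , _) (inj₂ (i<j , _)) = ℕₚ.<⇒≱ i<j (s≤s j≤i)

  hub-sees : ∀ h i → GridBand x y (inj₁ h) (inj₂ i)
  hub-sees zero       = left-hub-sees
  hub-sees (suc zero) = right-hub-sees

  K₂ₙ-weakURVG : IsWeakURVG (K 2 n)
  K₂ₙ-weakURVG = gridVisible⇒weakURVG (K 2 n) {x} {y} apart sees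
    where
    sees : ∀ v w → Adj (K 2 n) v w → GridVisible x y v w
    sees (inj₁ h) (inj₂ i) _ = inj₁ (hub-sees h i)
    sees (inj₂ i) (inj₁ h) _ = inj₁ (gridBand-sym {x = x} {y} {inj₁ h} {inj₂ i} (hub-sees h i))

-- Passing to subgraphs

URVG⇒weakURVG : ∀ G → IsURVG G → IsWeakURVG G
URVG⇒weakURVG G (S , disj , iff) = S , disj , λ v w v≢w → to (iff v w v≢w)

-- Deleting squares only removes obstructions, so every band that remains between kept squares stays
-- clear.
weakURVG-subgraph : ∀ G H (f : Vertex H → Vertex G) →
  (∀ {v w} → f v ≡ f w → v ≡ w) → (∀ {v w} → Adj H v w → Adj G (f v) (f w)) →
  IsWeakURVG G → IsWeakURVG H
weakURVG-subgraph G H f f-inj f-adj (S , disj , sees) =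
  S ∘ f , (λ v w v≢w → disj (f v) (f w) (v≢w ∘ f-inj)) ,
  λ v w v≢w adj → Sum.map (restrict S) (restrict (transpose ∘ S)) (sees (f v) (f w) (v≢w ∘ f-inj) (f-adj adj))
  where
  restrict : ∀ (T : Vertex G → UnitSquare) {v w} → HorizontalBand T (f v) (f w) → HorizontalBand (T ∘ f) v w
  restrict T (a , b , a<b , band) = a , b , a<b , λ y a<y y<b →
    let in-v , in-w , clear = band y a<y y<b in
    in-v , in-w , λ u u≢v u≢w → clear (f u) (u≢v ∘ f-inj) (u≢w ∘ f-inj)

-- Dropping hubs reduces the weak claims to m = 2 and m = 3.
K-weakURVG-≤ˡ : ∀ {m m′ n} → m ≤ m′ → IsWeakURVG (K m′ n) → IsWeakURVG (K m n)
K-weakURVG-≤ˡ {m} {m′} {n} m≤m′ =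
  weakURVG-subgraph (K m′ n) (K m n) f (λ {v} {w} → f-inj v w) (λ {v} {w} → f-adj v w)
  where
  f : Fin m ⊎ Fin n → Fin m′ ⊎ Fin n
  f = Sum.map₁ (λ i → inject≤ i m≤m′)

  f-inj : ∀ v w → f v ≡ f w → v ≡ w
  f-inj (inj₁ i) (inj₁ j) eq = cong inj₁ (inject≤-injective m≤m′ m≤m′ i j (inj₁-injective eq))
  f-inj (inj₂ i) (inj₂ j) eq = cong inj₂ (inj₂-injective eq)

  f-adj : ∀ v w → Adj (K m n) v w → Adj (K m′ n) (f v) (f w)
  f-adj (inj₁ _) (inj₂ _) _ = tt
  f-adj (inj₂ _) (inj₁ _) _ = tt

theorem5p1 : (m n : ℕ) → 1 ≤ m → m ≤ n →
    (((m ≤ 2 × n ≤ 6) ⊎ (m ≡ 3 × n ≤ 4)) → IsURVG (K m n)) ×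
    ((m ≤ 2 ⊎ (m ≤ 3 × n ≤ 4)) → IsWeakURVG (K m n))
theorem5p1 m n 1≤m m≤n = strict m 1≤m , weak
  where
  strict : ∀ m → 1 ≤ m → (m ≤ 2 × n ≤ 6) ⊎ (m ≡ 3 × n ≤ 4) → IsURVG (K m n)
  strict 1 _ (inj₁ (_ , n≤6))     = K₁ₙ-URVG (s≤s n≤6)
  strict 2 _ (inj₁ (_ , n≤6))     = K₂ₙ-URVG (s≤s n≤6)
  strict .3 _ (inj₂ (refl , n≤4)) = K₃ₙ-URVG (s≤s n≤4)
  strict (suc (suc (suc _))) _ (inj₁ (s≤s (s≤s ()) , _))

  weak : m ≤ 2 ⊎ (m ≤ 3 × n ≤ 4) → IsWeakURVG (K m n)
  weak (inj₁ m≤2)         = K-weakURVG-≤ˡ m≤2 (Staircase.K₂ₙ-weakURVG n)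
  weak (inj₂ (m≤3 , n≤4)) = K-weakURVG-≤ˡ m≤3 (URVG⇒weakURVG (K 3 n) (K₃ₙ-URVG (s≤s n≤4)))
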